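{- Let $t\ge1$, let $M_1,\dots,M_t$ be nonsingular matrices from $\mathbb{Z}^{2\times2}$ and let $\mathcal{S}_1,\dots,\mathcal{S}_t$ be regular subsets of $\mathrm{GL}(2,\mathbb{Z})$ (given by finite automata). Then it is decidable whether there exist $A_1\in\mathcal{S}_1,\dots,A_t\in\mathcal{S}_t$ such that $A_1M_1A_2M_2\cdots A_{t-1}M_{t-1}A_t=M_t$.
   Context: $\mathrm{GL}(2,\mathbb{Z})$ is the group of $2\times 2$ integer matrices with determinant $\pm1$. Let $\Sigma=\{X,N,S,R\}$ and $\phi:\Sigma^*\to\mathrm{GL}(2,\mathbb{Z})$ the monoid morphism determined by $\phi(X)=\begin{bmatrix}-1&0\\0&-1\end{bmatrix}$, $\phi(N)=\begin{bmatrix}1&0\\0&-1\end{bmatrix}$, $\phi(S)=\begin{bmatrix}0&-1\\1&0\end{bmatrix}$, $\phi(R)=\begin{bmatrix}0&-1\\1&1\end{bmatrix}$. A subset $\mathcal{S}\subseteq\mathrm{GL}(2,\mathbb{Z})$ is regular if $\mathcal{S}=\phi(L)$ for some regular language $L\subseteq\Sigma^*$. -}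

module Defs where

open import Data.Nat using (ℕ; zero; suc)
open import Data.Integer using (ℤ; _+_; _*_; -_; _-_; 0ℤ; 1ℤ)
open import Data.Fin using (Fin; zero; suc)
open import Data.Bool using (Bool; true)
open import Data.List using (List; []; _∷_)
open import Data.Product using (∃; _×_)
open import Relation.Binary.PropositionalEquality using (_≡_; _≢_)

record Mat : Set where
  constructor mat
  field
    a b c d : ℤ

open Mat public

_⊗_ : Mat → Mat → Mat
mat a₁ b₁ c₁ d₁ ⊗ mat a₂ b₂ c₂ d₂ =
  mat (a₁ * a₂ + b₁ * c₂) (a₁ * b₂ + b₁ * d₂)
      (c₁ * a₂ + d₁ * c₂) (c₁ * b₂ + d₁ * d₂)

I₂ : Mat
I₂ = mat 1ℤ 0ℤ 0ℤ 1ℤ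

det : Mat → ℤ
det (mat a b c d) = a * d - b * c

Nonsingular : Mat → Set
Nonsingular M = det M ≢ 0ℤ

data Σ : Set where
  X N S R : Σ

φₗ : Σ → Mat
φₗ X = mat (- 1ℤ) 0ℤ 0ℤ (- 1ℤ)
φₗ N = mat 1ℤ 0ℤ 0ℤ (- 1ℤ)
φₗ S = mat 0ℤ (- 1ℤ) 1ℤ 0ℤ
φₗ R = mat 0ℤ (- 1ℤ) 1ℤ 1ℤ

φ : List Σ → Mat
φ []       = I₂
φ (x ∷ w) = φₗ x ⊗ φ w

record NFA : Set where
  field
    states  : ℕ
    initial : Fin states → Bool
    final   : Fin states → Bool
    δ       : Fin states → Σ → Fin states → Bool

data AcceptsFrom (A : NFA) : Fin (NFA.states A) → List Σ → Set where
  done : ∀ {q} → NFA.final A q ≡ true → AcceptsFrom A q []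
  step : ∀ {q q′ x w} → NFA.δ A q x q′ ≡ true →
         AcceptsFrom A q′ w → AcceptsFrom A q (x ∷ w)

Accepts : NFA → List Σ → Set
Accepts A w = ∃ λ q → NFA.initial A q ≡ true × AcceptsFrom A q w

_∈ᵣ_ : Mat → NFA → Set
M ∈ᵣ A = ∃ λ w → Accepts A w × φ w ≡ M

alt : (k : ℕ) → (Fin (suc k) → Mat) → (Fin k → Mat) → Mat
alt zero    As Ms = As zero
alt (suc k) As Ms = (As zero ⊗ Ms zero) ⊗ alt k (λ i → As (suc i)) (λ i → Ms (suc i))

{-# OPTIONS --safe #-}
module Submission where

-- For nonsingular H and g ∈ GL(2,ℤ), the matrix H ⊗ g factors as u ⊗ H′ with u ∈ GL(2,ℤ) and H′
-- reduced in the sense of Gauss, and a reduced matrix is bounded in terms of its determinant. Hence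
-- a product of matrices can be read from left to right by a finite transducer whose memory is the
-- reduced remainder H, and the question becomes whether some path in a finite graph with edge
-- labels in GL(2,ℤ) has the label product I₂. As GL(2,ℤ) is the amalgam of the dihedral groups D₄
-- and D₆ over D₂, a word over F = D₄ ∪ D₆ with product I₂ and at least two letters has two adjacent
-- letters whose product is in F (otherwise the letters alternate between D₄ ∖ D₂ and D₆ ∖ D₂,
-- which ping-pong excludes). So all such paths are found by saturating the finite relation
-- "a path from u to v has the label product f ∈ F" under composition.

open import Defs
open import Data.Bool using (true)
import Data.Bool.Properties as Boolₚ
open import Data.Empty using (⊥)
open import Data.Fin using (Fin; zero; suc)
import Data.Fin.Properties as Finₚ
open import Data.Integer
  using (ℤ; +_; +[1+_]; -[1+_]; -1ℤ; 0ℤ; 1ℤ; _+_; _*_; -_; _-_; ∣_∣; _≤_; _<_; +≤+; +<+;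
         nonNegative; ≢-nonZero)
import Data.Integer.Properties as ℤₚ
open import Data.Integer.Tactic.RingSolver using (solve-∀)
open import Data.List
  using (List; []; _∷_; _++_; map; length; upTo; allFin; cartesianProduct; cartesianProductWith)
import Data.List.Membership.DecPropositional as DecMembership
open import Data.List.Membership.Propositional using (_∈_; _∉_; find; lose)
open import Data.List.Membership.Propositional.Properties
  using (∈-∃++; ∈-++⁺ˡ; ∈-++⁺ʳ; ∈-++⁻; ∈-map⁺; ∈-upTo⁺; ∈-allFin;
         ∈-cartesianProduct⁺; ∈-cartesianProduct⁻; ∈-cartesianProductWith⁺)
open import Data.List.Properties using (length-++-sucʳ)
open import Data.List.Relation.Unary.All as All using (All; []; _∷_; all?)
open import Data.List.Relation.Unary.Any using (Any; here; there; any?)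
open import Data.List.Relation.Unary.Linked using (Linked; [-]; _∷_)
open import Data.Nat using (ℕ; zero; suc)
import Data.Nat as ℕ
import Data.Nat.Properties as ℕₚ
open import Data.Product using (∃; ∃₂; _×_; _,_; proj₁; proj₂)
import Data.Product.Properties as ×ₚ
open import Data.Sum as Sum using (_⊎_; inj₁; inj₂)
import Data.Sum.Properties as ⊎ₚ
open import Data.Unit using (⊤; tt)
import Data.Unit.Properties as ⊤ₚ
import Data.Vec.Functional as Vector
open import Function using (_∘_; id)
open import Relation.Binary.Definitions using (DecidableEquality)
open import Relation.Binary.PropositionalEquality
open import Relation.Nullary using (Dec; yes; no; ¬_; contradiction)
open import Relation.Nullary.Decidable
  using (map′; ¬?; _×-dec_; _⊎-dec_; _→-dec_; toWitness; toWitnessFalse)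
open import Relation.Unary using (Decidable)

-- Matrices

mat-≡ : ∀ {a₁ b₁ c₁ d₁ a₂ b₂ c₂ d₂} → a₁ ≡ a₂ → b₁ ≡ b₂ → c₁ ≡ c₂ → d₁ ≡ d₂ →
        mat a₁ b₁ c₁ d₁ ≡ mat a₂ b₂ c₂ d₂
mat-≡ refl refl refl refl = refl

infix 4 _≟_
_≟_ : DecidableEquality Mat
mat a₁ b₁ c₁ d₁ ≟ mat a₂ b₂ c₂ d₂ =
  map′ (λ (p , q , r , s) → mat-≡ p q r s)
       (λ { refl → refl , refl , refl , refl })
       (a₁ ℤₚ.≟ a₂ ×-dec b₁ ℤₚ.≟ b₂ ×-dec c₁ ℤₚ.≟ c₂ ×-dec d₁ ℤₚ.≟ d₂)

⊗-identityˡ : ∀ A → I₂ ⊗ A ≡ A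
⊗-identityˡ (mat a b c d) = mat-≡ (top a c) (top b d) (bot a c) (bot b d)
  where
  top : ∀ x y → 1ℤ * x + 0ℤ * y ≡ x
  top = solve-∀
  bot : ∀ x y → 0ℤ * x + 1ℤ * y ≡ y
  bot = solve-∀

⊗-identityʳ : ∀ A → A ⊗ I₂ ≡ A
⊗-identityʳ (mat a b c d) = mat-≡ (left a b) (right a b) (left c d) (right c d)
  where
  left : ∀ x y → x * 1ℤ + y * 0ℤ ≡ x
  left = solve-∀
  right : ∀ x y → x * 0ℤ + y * 1ℤ ≡ y
  right = solve-∀

⊗-assoc : ∀ A B C → (A ⊗ B) ⊗ C ≡ A ⊗ (B ⊗ C)
⊗-assoc (mat a b c d) (mat e f g h) (mat i j k l) =
  mat-≡ (entry a b e f g h i k) (entry a b e f g h j l)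
        (entry c d e f g h i k) (entry c d e f g h j l)
  where
  entry : ∀ x y e f g h u v →
          (x * e + y * g) * u + (x * f + y * h) * v ≡ x * (e * u + f * v) + y * (g * u + h * v)
  entry = solve-∀

det-⊗ : ∀ A B → det (A ⊗ B) ≡ det A * det B
det-⊗ (mat a b c d) (mat e f g h) = identity a b c d e f g h
  where
  identity : ∀ a b c d e f g h →
    (a * e + b * g) * (c * f + d * h) - (a * f + b * h) * (c * e + d * g)
    ≡ (a * d - b * c) * (e * h - f * g)
  identity = solve-∀

adj : Mat → Mat
adj (mat a b c d) = mat d (- b) (- c) a

infixr 7 _·_
_·_ : ℤ → Mat → Mat
k · mat a b c d = mat (k * a) (k * b) (k * c) (k * d)

·-assoc : ∀ j k A → j · k · A ≡ (j * k) · A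
·-assoc j k (mat a b c d) = mat-≡ (e a) (e b) (e c) (e d)
  where
  e : ∀ x → j * (k * x) ≡ j * k * x
  e x = sym (ℤₚ.*-assoc j k x)

·-⊗ : ∀ k A B → (k · A) ⊗ B ≡ k · (A ⊗ B)
·-⊗ k (mat a b c d) (mat e f g h) =
  mat-≡ (entry k a b e g) (entry k a b f h) (entry k c d e g) (entry k c d f h)
  where
  entry : ∀ k x y u v → k * x * u + k * y * v ≡ k * (x * u + y * v)
  entry = solve-∀

·-cancel : ∀ k {A B} → k ≢ 0ℤ → k · A ≡ k · B → A ≡ B
·-cancel k {A} {B} k≢0 eq =
  mat-≡ (e (cong a eq)) (e (cong b eq)) (e (cong c eq)) (e (cong d eq))
  where
  e : ∀ {x y} → k * x ≡ k * y → x ≡ y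
  e = ℤₚ.*-cancelˡ-≡ k _ _ {{≢-nonZero k≢0}}

adj-inverseˡ : ∀ A → adj A ⊗ A ≡ det A · I₂
adj-inverseˡ (mat a b c d) =
  mat-≡ (e₁ a b c d) (e₂ b d (a * d - b * c)) (e₃ a c (a * d - b * c)) (e₄ a b c d)
  where
  e₁ : ∀ a b c d → d * a + - b * c ≡ (a * d - b * c) * 1ℤ
  e₁ = solve-∀
  e₂ : ∀ b d k → d * b + - b * d ≡ k * 0ℤ
  e₂ = solve-∀
  e₃ : ∀ a c k → - c * a + a * c ≡ k * 0ℤ
  e₃ = solve-∀
  e₄ : ∀ a b c d → - c * b + a * d ≡ (a * d - b * c) * 1ℤ
  e₄ = solve-∀

adj-inverseʳ : ∀ A → A ⊗ adj A ≡ det A · I₂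
adj-inverseʳ (mat a b c d) =
  mat-≡ (e₁ a b c d) (e₂ a b (a * d - b * c)) (e₃ c d (a * d - b * c)) (e₄ a b c d)
  where
  e₁ : ∀ a b c d → a * d + b * - c ≡ (a * d - b * c) * 1ℤ
  e₁ = solve-∀
  e₂ : ∀ a b k → a * - b + b * a ≡ k * 0ℤ
  e₂ = solve-∀
  e₃ : ∀ c d k → c * d + d * - c ≡ k * 0ℤ
  e₃ = solve-∀
  e₄ : ∀ a b c d → c * - b + d * a ≡ (a * d - b * c) * 1ℤ
  e₄ = solve-∀

adj-det : ∀ A → det (adj A) ≡ det A
adj-det (mat a b c d) = e a b c d
  where
  e : ∀ a b c d → d * a - - b * - c ≡ a * d - b * c
  e = solve-∀

·I-⊗ : ∀ k A → (k · I₂) ⊗ A ≡ k · A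
·I-⊗ k A = trans (·-⊗ k I₂ A) (cong (k ·_) (⊗-identityˡ A))

⊗-cancelˡ : ∀ G {A B} → det G ≢ 0ℤ → G ⊗ A ≡ G ⊗ B → A ≡ B
⊗-cancelˡ G {A} {B} g≢0 eq = ·-cancel (det G) g≢0 (begin
  det G · A        ≡⟨ scaled A ⟨
  adj G ⊗ (G ⊗ A)  ≡⟨ cong (adj G ⊗_) eq ⟩
  adj G ⊗ (G ⊗ B)  ≡⟨ scaled B ⟩
  det G · B        ∎)
  where
  open ≡-Reasoning
  scaled : ∀ M → adj G ⊗ (G ⊗ M) ≡ det G · M
  scaled M = trans (sym (⊗-assoc (adj G) G M))
    (trans (cong (_⊗ M) (adj-inverseˡ G)) (·I-⊗ (det G) M))

⊗-·I : ∀ A k → A ⊗ (k · I₂) ≡ k · A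
⊗-·I (mat a b c d) k = mat-≡ (e₁ a b k) (e₂ a b k) (e₁ c d k) (e₂ c d k)
  where
  e₁ : ∀ x y k → x * (k * 1ℤ) + y * (k * 0ℤ) ≡ k * x
  e₁ = solve-∀
  e₂ : ∀ x y k → x * (k * 0ℤ) + y * (k * 1ℤ) ≡ k * y
  e₂ = solve-∀

-- det², norm and F are opaque because later goals become unmanageably large when they are unfolded.
opaque
  det² : Mat → ℤ
  det² A = det A * det A

opaque
  unfolding det²

  det²-⊗ : ∀ A B → det² (A ⊗ B) ≡ det² A * det² B
  det²-⊗ A B = trans (cong (λ k → k * k) (det-⊗ A B)) (e (det A) (det B))
    where
    e : ∀ x y → x * y * (x * y) ≡ x * x * (y * y)
    e = solve-∀

-- Merges the determinants 1 and -1 into one equation, which is multiplicative and decided by a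
-- single test.
Unimodular : Mat → Set
Unimodular A = det² A ≡ 1ℤ

opaque
  unfolding det²

  unimodular⇒nonsingular : ∀ A → Unimodular A → det A ≢ 0ℤ
  unimodular⇒nonsingular A p q with det A
  unimodular⇒nonsingular A () refl | _

  -- As `det U` is its own inverse, `det U · adj U` inverts `U`.
  inverse : ∀ U → Unimodular U → ∃ λ G → Unimodular G × G ⊗ U ≡ I₂
  inverse U u = det U · adj U , trans (cong (λ k → k * k) (det-· (det U) (adj U))) eq , (begin
    (det U · adj U) ⊗ U    ≡⟨ ·-⊗ (det U) (adj U) U ⟩
    det U · (adj U ⊗ U)    ≡⟨ cong (det U ·_) (adj-inverseˡ U) ⟩
    det U · det U · I₂     ≡⟨ ·-assoc (det U) (det U) I₂ ⟩
    det² U · I₂            ≡⟨ cong (_· I₂) u ⟩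
    I₂                     ∎)
    where
    open ≡-Reasoning
    det-· : ∀ k A → det (k · A) ≡ k * k * det A
    det-· k (mat a b c d) = e k a b c d
      where
      e : ∀ k a b c d → k * a * (k * d) - k * b * (k * c) ≡ k * k * (a * d - b * c)
      e = solve-∀
    eq : det² U * det (adj U) * (det² U * det (adj U)) ≡ 1ℤ
    eq rewrite adj-det U | u = trans (cong₂ _*_ (ℤₚ.*-identityˡ (det U)) (ℤₚ.*-identityˡ (det U))) u

-- Integer inequalities and the squared Frobenius norm

sq-nonNeg : ∀ x → 0ℤ ≤ x * x
sq-nonNeg (+ n)    = subst (0ℤ ≤_) (ℤₚ.pos-* n n) (+≤+ ℕ.z≤n)
sq-nonNeg -[1+ n ] = +≤+ ℕ.z≤n

*-nonNeg : ∀ {x y} → 0ℤ ≤ x → 0ℤ ≤ y → 0ℤ ≤ x * y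
*-nonNeg {+ m} {+ n} _ _ = subst (0ℤ ≤_) (ℤₚ.pos-* m n) (+≤+ ℕ.z≤n)

sq≥1 : ∀ {x} → x ≢ 0ℤ → 1ℤ ≤ x * x
sq≥1 {+ zero}    x≢0 = contradiction refl x≢0
sq≥1 { +[1+ n ]} x≢0 = +≤+ (ℕ.s≤s ℕ.z≤n)
sq≥1 { -[1+ n ]} x≢0 = +≤+ (ℕ.s≤s ℕ.z≤n)

-- Reduces a polynomial inequality to a ring identity with an explicit nonnegative difference.
≤-by : ∀ {x y} e → 0ℤ ≤ e → y ≡ x + e → x ≤ y
≤-by {x} e 0≤e refl = subst (_≤ x + e) (ℤₚ.+-identityʳ x) (ℤₚ.+-monoʳ-≤ x 0≤e)

≤-scale : ∀ {x k} → 0ℤ ≤ x → 1ℤ ≤ k → x ≤ k * x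
≤-scale {x} {k} 0≤x 1≤k =
  ≤-by ((k - 1ℤ) * x) (*-nonNeg (ℤₚ.i≤j⇒0≤j-i 1≤k) 0≤x) (e k x)
  where
  e : ∀ k x → k * x ≡ x + (k - 1ℤ) * x
  e = solve-∀

*-mono-≤ : ∀ {x x′ y y′} → 0ℤ ≤ x → 0ℤ ≤ y′ → x ≤ x′ → y ≤ y′ → x * y ≤ x′ * y′
*-mono-≤ {x} {x′} {y} {y′} 0≤x 0≤y′ p q =
  ℤₚ.≤-trans (ℤₚ.*-monoˡ-≤-nonNeg x {{nonNegative 0≤x}} q)
             (ℤₚ.*-monoʳ-≤-nonNeg y′ {{nonNegative 0≤y′}} p)

opaque
  norm : Mat → ℤ
  norm (mat a b c d) = a * a + b * b + c * c + d * d

sum-nonNeg : ∀ {w x y z} → 0ℤ ≤ w → 0ℤ ≤ x → 0ℤ ≤ y → 0ℤ ≤ z → 0ℤ ≤ w + x + y + z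
sum-nonNeg p q r s = ℤₚ.+-mono-≤ (ℤₚ.+-mono-≤ (ℤₚ.+-mono-≤ p q) r) s

opaque
  unfolding norm

  norm-nonNeg : ∀ A → 0ℤ ≤ norm A
  norm-nonNeg (mat a b c d) = sum-nonNeg (sq-nonNeg a) (sq-nonNeg b) (sq-nonNeg c) (sq-nonNeg d)

  -- The defect in the Cauchy–Schwarz inequality is a sum of squares.
  norm-⊗ : ∀ A B → norm (A ⊗ B) ≤ norm A * norm B
  norm-⊗ (mat a b c d) (mat e f g h) =
    ≤-by (w * w + x * x + y * y + z * z)
         (sum-nonNeg (sq-nonNeg w) (sq-nonNeg x) (sq-nonNeg y) (sq-nonNeg z))
         (identity a b c d e f g h)
    where
    w x y z : ℤ
    w = a * g - b * e
    x = a * h - b * f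
    y = c * g - d * e
    z = c * h - d * f
    identity : ∀ a b c d e f g h →
      (a * a + b * b + c * c + d * d) * (e * e + f * f + g * g + h * h) ≡
      (a * e + b * g) * (a * e + b * g) + (a * f + b * h) * (a * f + b * h)
        + (c * e + d * g) * (c * e + d * g) + (c * f + d * h) * (c * f + d * h)
      + ((a * g - b * e) * (a * g - b * e) + (a * h - b * f) * (a * h - b * f)
        + (c * g - d * e) * (c * g - d * e) + (c * h - d * f) * (c * h - d * f))
    identity = solve-∀

norm-⊗-≤ : ∀ A B {k l} → norm A ≤ k → norm B ≤ l → norm (A ⊗ B) ≤ k * l
norm-⊗-≤ A B p q =
  ℤₚ.≤-trans (norm-⊗ A B) (*-mono-≤ (norm-nonNeg A) (ℤₚ.≤-trans (norm-nonNeg B) q) p q)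

-- Ping-pong in GL(2,ℤ)

open DecMembership _≟_ using (_∈?_)

-- With J = mat 0 1 1 0, core is D₂ = {±I₂, ±J}, outer₄ is D₄ ∖ D₂ for the group D₄ of signed
-- permutation matrices, and outer₆ is D₆ ∖ D₂ for the group D₆ generated by φₗ R and J.
core outer₄ outer₆ : List Mat
core = mat 1ℤ 0ℤ 0ℤ 1ℤ ∷ mat -1ℤ 0ℤ 0ℤ -1ℤ ∷ mat 0ℤ 1ℤ 1ℤ 0ℤ ∷ mat 0ℤ -1ℤ -1ℤ 0ℤ ∷ []
outer₄ = mat 0ℤ -1ℤ 1ℤ 0ℤ ∷ mat 0ℤ 1ℤ -1ℤ 0ℤ ∷ mat 1ℤ 0ℤ 0ℤ -1ℤ ∷ mat -1ℤ 0ℤ 0ℤ 1ℤ ∷ []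
outer₆ = mat 0ℤ -1ℤ 1ℤ 1ℤ ∷ mat 0ℤ 1ℤ -1ℤ -1ℤ ∷ mat 1ℤ 1ℤ -1ℤ 0ℤ ∷ mat -1ℤ -1ℤ 1ℤ 0ℤ
  ∷ mat 1ℤ 1ℤ 0ℤ -1ℤ ∷ mat -1ℤ -1ℤ 0ℤ 1ℤ ∷ mat 1ℤ 0ℤ -1ℤ -1ℤ ∷ mat -1ℤ 0ℤ 1ℤ 1ℤ ∷ []

opaque
  F : List Mat
  F = core ++ outer₄ ++ outer₆

data Alternates (f g : Mat) : Set where
  ₄₆ : f ∈ outer₄ → g ∈ outer₆ → Alternates f g
  ₆₄ : f ∈ outer₆ → g ∈ outer₄ → Alternates f g

opaque
  unfolding F

  I∈F : I₂ ∈ F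
  I∈F = here refl

  -- A check of all 256 products. Letters of a common subgroup D₄ or D₆ multiply within it;
  -- otherwise neither lies in D₂, and they alternate.
  F-product : ∀ {f g} → f ∈ F → g ∈ F → f ⊗ g ∈ F ⊎ Alternates f g
  F-product f∈F g∈F = All.lookup (All.lookup table f∈F) g∈F
    where
    alternates? : ∀ f g → Dec (Alternates f g)
    alternates? f g =
      map′ (λ { (inj₁ (p , q)) → ₄₆ p q ; (inj₂ (p , q)) → ₆₄ p q })
           (λ { (₄₆ p q) → inj₁ (p , q) ; (₆₄ p q) → inj₂ (p , q) })
           ((f ∈? outer₄ ×-dec g ∈? outer₆) ⊎-dec (f ∈? outer₆ ×-dec g ∈? outer₄))
    table : All (λ f → All (λ g → f ⊗ g ∈ F ⊎ Alternates f g) F) F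
    table = toWitness {a? = all? (λ f → all? (λ g → f ⊗ g ∈? F ⊎-dec alternates? f g) F) F} _

disjoint : ∀ {f} → f ∈ outer₄ → f ∉ outer₆
disjoint {f} = All.lookup {P = _∉ outer₆} (toWitness {a? = all? (λ f → ¬? (f ∈? outer₆)) outer₄} _)

Vec₂ : Set
Vec₂ = ℤ × ℤ

act : Mat → Vec₂ → Vec₂
act (mat a b c d) (x , y) = a * x + b * y , c * x + d * y

act-⊗ : ∀ A B v → act (A ⊗ B) v ≡ act A (act B v)
act-⊗ (mat a b c d) (mat e f g h) (x , y) =
  cong₂ _,_ (entry a b e f g h x y) (entry c d e f g h x y)
  where
  entry : ∀ a b e f g h x y →
    (a * e + b * g) * x + (a * f + b * h) * y ≡ a * (e * x + f * y) + b * (g * x + h * y)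
  entry = solve-∀

-- The sign of `slope` separates the two pairs of opposite open quadrants, the two sets of the
-- ping-pong game.
slope length² : Vec₂ → ℤ
slope (x , y) = x * y
length² (x , y) = x * x + y * y

-- The coefficients of slope (act f (x , y)) and length² (act f (x , y)) as quadratic forms in
-- x and y, where l₁₂ is half of the coefficient of x * y.
record Forms : Set where
  constructor forms
  field s₁₁ s₁₂ s₂₂ l₁₁ l₁₂ l₂₂ : ℤ

formsOf : Mat → Forms
formsOf (mat a b c d) =
  forms (a * c) (a * d + b * c) (b * d) (a * a + c * c) (a * b + c * d) (b * b + d * d)

slope-act : ∀ {s₁₁ s₁₂ s₂₂ l₁₁ l₁₂ l₂₂} f → formsOf f ≡ forms s₁₁ s₁₂ s₂₂ l₁₁ l₁₂ l₂₂ →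
  ∀ x y → slope (act f (x , y)) ≡ s₁₁ * (x * x) + s₁₂ * (x * y) + s₂₂ * (y * y)
slope-act (mat a b c d) refl = identity a b c d
  where
  identity : ∀ a b c d x y →
    (a * x + b * y) * (c * x + d * y) ≡ a * c * (x * x) + (a * d + b * c) * (x * y) + b * d * (y * y)
  identity = solve-∀

length²-act : ∀ {s₁₁ s₁₂ s₂₂ l₁₁ l₁₂ l₂₂} f → formsOf f ≡ forms s₁₁ s₁₂ s₂₂ l₁₁ l₁₂ l₂₂ →
  ∀ x y → length² (act f (x , y)) ≡ l₁₁ * (x * x) + + 2 * l₁₂ * (x * y) + l₂₂ * (y * y)
length²-act (mat a b c d) refl = identity a b c d
  where
  identity : ∀ a b c d x y →
    (a * x + b * y) * (a * x + b * y) + (c * x + d * y) * (c * x + d * y) ≡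
    (a * a + c * c) * (x * x) + + 2 * (a * b + c * d) * (x * y) + (b * b + d * d) * (y * y)
  identity = solve-∀

-- Swapping the rows of `f` or negating `f` changes neither quadratic form, so both depend only on
-- the coset D₂f. `outer₄` is one such coset, and `outer₆` consists of two.
outer₄-forms : ∀ {f} → f ∈ outer₄ → formsOf f ≡ forms 0ℤ -1ℤ 0ℤ 1ℤ 0ℤ 1ℤ
outer₄-forms = All.lookup {P = λ f → formsOf f ≡ _} (refl ∷ refl ∷ refl ∷ refl ∷ [])

outer₆-forms : ∀ {f} → f ∈ outer₆ →
  formsOf f ≡ forms 0ℤ -1ℤ -1ℤ 1ℤ 1ℤ (+ 2) ⊎ formsOf f ≡ forms -1ℤ -1ℤ 0ℤ (+ 2) 1ℤ 1ℤ
outer₆-forms = All.lookup {P = λ f → formsOf f ≡ _ ⊎ formsOf f ≡ _}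
  (inj₁ refl ∷ inj₁ refl ∷ inj₂ refl ∷ inj₂ refl ∷ inj₁ refl ∷ inj₁ refl ∷ inj₂ refl ∷ inj₂ refl ∷ [])

outer₄-slope : ∀ {f} → f ∈ outer₄ → ∀ v → slope (act f v) ≡ - slope v
outer₄-slope {f} f∈ (x , y) =
  trans (slope-act f (outer₄-forms f∈) x y) (identity (x * x) (x * y) (y * y))
  where
  identity : ∀ p q r → 0ℤ * p + -1ℤ * q + 0ℤ * r ≡ - q
  identity = solve-∀

outer₄-length² : ∀ {f} → f ∈ outer₄ → ∀ v → length² (act f v) ≡ length² v
outer₄-length² {f} f∈ (x , y) =
  trans (length²-act f (outer₄-forms f∈) x y) (identity (x * x) (x * y) (y * y))
  where
  identity : ∀ p q r → 1ℤ * p + + 2 * 0ℤ * q + 1ℤ * r ≡ p + r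
  identity = solve-∀

outer₆-slope : ∀ {f} → f ∈ outer₆ → ∀ v → 0ℤ < slope v → slope (act f v) < 0ℤ
outer₆-slope {f} f∈ (x , y) 0<s with outer₆-forms f∈
... | inj₁ eq = subst (_< 0ℤ) (sym (trans (slope-act f eq x y) (identity (x * x) (x * y) (y * y))))
                  (ℤₚ.neg-mono-< (ℤₚ.+-mono-<-≤ 0<s (sq-nonNeg y)))
  where
  identity : ∀ p q r → 0ℤ * p + -1ℤ * q + -1ℤ * r ≡ - (q + r)
  identity = solve-∀
... | inj₂ eq = subst (_< 0ℤ) (sym (trans (slope-act f eq x y) (identity (x * x) (x * y) (y * y))))
                  (ℤₚ.neg-mono-< (ℤₚ.+-mono-<-≤ 0<s (sq-nonNeg x)))
  where
  identity : ∀ p q r → -1ℤ * p + -1ℤ * q + 0ℤ * r ≡ - (q + p)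
  identity = solve-∀

-- On both cosets the gain is twice the slope plus a square.
outer₆-length² : ∀ {f} → f ∈ outer₆ → ∀ v → 0ℤ < slope v → length² v < length² (act f v)
outer₆-length² {f} f∈ v@(x , y) 0<s with outer₆-forms f∈
... | inj₁ eq = subst₂ _<_ (ℤₚ.+-identityʳ (length² v))
                  (sym (trans (length²-act f eq x y) (identity (x * x) (x * y) (y * y))))
                  (ℤₚ.+-monoʳ-< (length² v) (ℤₚ.+-mono-<-≤ (ℤₚ.+-mono-< 0<s 0<s) (sq-nonNeg y)))
  where
  identity : ∀ p q r → 1ℤ * p + + 2 * 1ℤ * q + + 2 * r ≡ p + r + (q + q + r)
  identity = solve-∀
... | inj₂ eq = subst₂ _<_ (ℤₚ.+-identityʳ (length² v))
                  (sym (trans (length²-act f eq x y) (identity (x * x) (x * y) (y * y))))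
                  (ℤₚ.+-monoʳ-< (length² v) (ℤₚ.+-mono-<-≤ (ℤₚ.+-mono-< 0<s 0<s) (sq-nonNeg x)))
  where
  identity : ∀ p q r → + 2 * p + + 2 * 1ℤ * q + 1ℤ * r ≡ p + r + (q + q + p)
  identity = solve-∀

∏ : List Mat → Mat
∏ []       = I₂
∏ (f ∷ fs) = f ⊗ ∏ fs

-- Ping-pong: a suitable vector of squared length 2 is moved to the half-plane
-- belonging to the first letter, and becomes longer once a letter of order 6 has acted.
data Ponged (f : Mat) (v v₀ : Vec₂) : Set where
  by₄ : f ∈ outer₄ → 0ℤ < slope v → length² v₀ ≤ length² v → Ponged f v v₀
  by₆ : f ∈ outer₆ → slope v < 0ℤ → length² v₀ < length² v → Ponged f v v₀

act₁ : ∀ f v → act (∏ (f ∷ [])) v ≡ act f v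
act₁ f v = cong (λ A → act A v) (⊗-identityʳ f)

pong₁ : ∀ {f} → f ∈ outer₄ ⊎ f ∈ outer₆ → ∃ λ v₀ → Ponged f (act (∏ (f ∷ [])) v₀) v₀
pong₁ {f} (inj₁ f∈) = v₀ , subst (λ v → Ponged f v v₀) (sym (act₁ f v₀))
  (by₄ f∈ (subst (0ℤ <_) (sym (outer₄-slope f∈ v₀)) (+<+ (ℕ.s≤s ℕ.z≤n)))
       (ℤₚ.≤-reflexive (sym (outer₄-length² f∈ v₀))))
  -- Its slope is negative, and `outer₄` makes it positive; for `outer₆` the start has positive
  -- slope instead.
  where v₀ = 1ℤ , -1ℤ
pong₁ {f} (inj₂ f∈) = v₀ , subst (λ v → Ponged f v v₀) (sym (act₁ f v₀))
  (by₆ f∈ (outer₆-slope f∈ v₀ (+<+ (ℕ.s≤s ℕ.z≤n))) (outer₆-length² f∈ v₀ (+<+ (ℕ.s≤s ℕ.z≤n))))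
  where v₀ = 1ℤ , 1ℤ

-- One of the two adjacent letters lies in `outer₆`. If it is `g`, the length has already grown and
-- `f` keeps it; if it is `f`, the growth happens now.
pong-step : ∀ {f g v v₀} → Alternates f g → Ponged g v v₀ →
            Ponged f (act f v) v₀ × length² v₀ < length² (act f v)
pong-step {v = v} {v₀} (₄₆ f∈ _) (by₆ _ s l) =
  by₄ f∈ (subst (0ℤ <_) (sym (outer₄-slope f∈ v)) (ℤₚ.neg-mono-< s)) (ℤₚ.<⇒≤ l′) , l′
  where l′ = subst (length² v₀ <_) (sym (outer₄-length² f∈ v)) l
pong-step {v = v} (₆₄ f∈ _) (by₄ _ s l) = by₆ f∈ (outer₆-slope f∈ v s) l′ , l′
  where l′ = ℤₚ.≤-<-trans l (outer₆-length² f∈ v s)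
pong-step (₄₆ _ g∈₆) (by₄ g∈₄ _ _) = contradiction g∈₆ (disjoint g∈₄)
pong-step (₆₄ _ g∈₄) (by₆ g∈₆ _ _) = contradiction g∈₆ (disjoint g∈₄)

pong : ∀ {f g fs} → Linked Alternates (f ∷ g ∷ fs) →
  ∃ λ v₀ → Ponged f (act (∏ (f ∷ g ∷ fs)) v₀) v₀ × length² v₀ < length² (act (∏ (f ∷ g ∷ fs)) v₀)
pong {f} {g} {fs} (alt ∷ rest) with tail rest
  where
  letter : Alternates f g → g ∈ outer₄ ⊎ g ∈ outer₆
  letter (₄₆ _ g∈) = inj₂ g∈
  letter (₆₄ _ g∈) = inj₁ g∈
  tail : ∀ {hs} → Linked Alternates (g ∷ hs) → ∃ λ v₀ → Ponged g (act (∏ (g ∷ hs)) v₀) v₀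
  tail [-]            = pong₁ (letter alt)
  tail l@(_ ∷ _) with v₀ , p , _ ← pong l = v₀ , p
... | v₀ , p = v₀ , subst (λ v → Ponged f v v₀ × length² v₀ < length² v)
                          (sym (act-⊗ f (∏ (g ∷ fs)) v₀)) (pong-step alt p)

alternating≢I : ∀ {f g fs} → Linked Alternates (f ∷ g ∷ fs) → ∏ (f ∷ g ∷ fs) ≢ I₂
alternating≢I linked eq with v₀@(x , y) , _ , longer ← pong linked =
  ℤₚ.<-irrefl (sym (trans (cong (λ A → length² (act A v₀)) eq)
                          (cong₂ (λ x y → x * x + y * y) (top x y) (bot x y)))) longer
  where
  top : ∀ x y → 1ℤ * x + 0ℤ * y ≡ x
  top = solve-∀
  bot : ∀ x y → 0ℤ * x + 1ℤ * y ≡ y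
  bot = solve-∀

-- Paths with trivial label product

-- Bottom-up computation of an inductively defined subset of a finite set.
module Saturation {A : Set} (universe : List A)
  {Base : A → Set} (base? : Decidable Base)
  {Rule : A → A → A → Set} (rule? : ∀ x y z → Dec (Rule x y z)) where

  data Derivable : A → Set where
    base : ∀ {x} → x ∈ universe → Base x → Derivable x
    rule : ∀ {x y z} → z ∈ universe → Derivable x → Derivable y → Rule x y z → Derivable z

  private
    Immediate : List A → A → Set
    Immediate known z = Base z ⊎ Any (λ x → Any (λ y → Rule x y z) known) known

    immediate? : ∀ known → Decidable (Immediate known)
    immediate? known z = base? z ⊎-dec any? (λ x → any? (λ y → rule? x y z) known) known

    derive : ∀ {known z} → All Derivable known → z ∈ universe → Immediate known z → Derivable z
    derive ds z∈ (inj₁ b) = base z∈ b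
    derive ds z∈ (inj₂ p)
      with x , x∈ , q ← find p
      with y , y∈ , r ← find q = rule z∈ (All.lookup ds x∈) (All.lookup ds y∈) r

    Saturated : Set
    Saturated = ∃ λ known → All Derivable known × (∀ {x} → Derivable x → x ∈ known)

    -- `rest` covers the elements not yet known, and its length bounds the number of rounds. A round
    -- moves one immediately derivable element to `known`; when there is none, `known` is closed
    -- under both constructors of `Derivable`.
    loop : ∀ n known rest → length rest ≡ n → All Derivable known →
           (∀ {x} → x ∈ rest → x ∈ universe) →
           (∀ {x} → x ∈ universe → x ∈ known ⊎ x ∈ rest) → Saturated
    loop n known rest len ds rest⊆ cover with any? (immediate? known) rest
    ... | no stuck = known , ds , closed
      where
      settle : ∀ {z} → z ∈ universe → Immediate known z → z ∈ known
      settle z∈ imm with cover z∈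
      ... | inj₁ z∈known = z∈known
      ... | inj₂ z∈rest  = contradiction (lose z∈rest imm) stuck
      closed : ∀ {x} → Derivable x → x ∈ known
      closed (base z∈ b)      = settle z∈ (inj₁ b)
      closed (rule z∈ dx dy r) = settle z∈ (inj₂ (lose (closed dx) (lose (closed dy) r)))
    loop zero    known []   len ds rest⊆ cover | yes ()
    loop (suc n) known rest len ds rest⊆ cover | yes p
      with z , z∈ , imm ← find p
      with ys , zs , refl ← ∈-∃++ z∈ =
      loop n (z ∷ known) (ys ++ zs)
        (ℕₚ.suc-injective (trans (sym (length-++-sucʳ ys z zs)) len))
        (derive ds (rest⊆ z∈) imm ∷ ds) (rest⊆ ∘ embed) (split ∘ cover)
      where
      embed : ∀ {x} → x ∈ ys ++ zs → x ∈ ys ++ z ∷ zs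
      embed x∈ with ∈-++⁻ ys x∈
      ... | inj₁ x∈ys = ∈-++⁺ˡ x∈ys
      ... | inj₂ x∈zs = ∈-++⁺ʳ ys (there x∈zs)
      split : ∀ {x} → x ∈ known ⊎ x ∈ ys ++ z ∷ zs → x ∈ z ∷ known ⊎ x ∈ ys ++ zs
      split (inj₁ x∈) = inj₁ (there x∈)
      split (inj₂ x∈) with ∈-++⁻ ys x∈
      ... | inj₁ x∈ys         = inj₂ (∈-++⁺ˡ x∈ys)
      ... | inj₂ (here refl)  = inj₁ (here refl)
      ... | inj₂ (there x∈zs) = inj₂ (∈-++⁺ʳ ys x∈zs)

  saturate : ∃ λ known → All Derivable known × (∀ {x} → Derivable x → x ∈ known)
  saturate = loop (length universe) [] universe refl [] id inj₂

-- Serves twice: for the runs of a machine and for the walks in the graph of remainders.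
module Walks {V : Set} (E : V → Mat → V → Set) where

  data Walk : V → Mat → V → Set where
    []  : ∀ {v} → Walk v I₂ v
    _∷_ : ∀ {u f v A w} → E u f v → Walk v A w → Walk u (f ⊗ A) w

  infixr 5 _++ʷ_
  _++ʷ_ : ∀ {u A v B w} → Walk u A v → Walk v B w → Walk u (A ⊗ B) w
  _++ʷ_ {B = B} [] q = subst (λ C → Walk _ C _) (sym (⊗-identityˡ B)) q
  _++ʷ_ {B = B} (_∷_ {f = f} {A = A} e p) q =
    subst (λ C → Walk _ C _) (sym (⊗-assoc f A B)) (e ∷ (p ++ʷ q))

module IdentityWalks {V : Set} (_≟ᵥ_ : DecidableEquality V) (vs : List V)
  {E : V → Mat → V → Set} (E? : ∀ u f v → Dec (E u f v))
  (E⊆ : ∀ {u f v} → E u f v → u ∈ vs × f ∈ F × v ∈ vs) where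

  open Walks E

  private
    Item : Set
    Item = V × Mat × V

    Base : Item → Set
    Base (u , f , v) = E u f v ⊎ (f ≡ I₂ × u ≡ v)

    Rule : Item → Item → Item → Set
    Rule (u , f , v) (v′ , g , w) (u′ , h , w′) = u ≡ u′ × v ≡ v′ × w ≡ w′ × f ⊗ g ≡ h

    universe : List Item
    universe = cartesianProduct vs (cartesianProduct F vs)

    universe⁺ : ∀ {u f v} → u ∈ vs → f ∈ F → v ∈ vs → (u , f , v) ∈ universe
    universe⁺ u∈ f∈ v∈ = ∈-cartesianProduct⁺ u∈ (∈-cartesianProduct⁺ f∈ v∈)

    universe⁻ : ∀ {u f v} → (u , f , v) ∈ universe → u ∈ vs × f ∈ F × v ∈ vs
    universe⁻ p with u∈ , q ← ∈-cartesianProduct⁻ vs (cartesianProduct F vs) p =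
      u∈ , ∈-cartesianProduct⁻ F vs q

    open Saturation universe {Base} (λ (u , f , v) → E? u f v ⊎-dec (f ≟ I₂ ×-dec u ≟ᵥ v))
      {Rule} (λ (u , f , v) (v′ , g , w) (u′ , h , w′) →
        u ≟ᵥ u′ ×-dec v ≟ᵥ v′ ×-dec w ≟ᵥ w′ ×-dec f ⊗ g ≟ h)

    in-universe : ∀ {x} → Derivable x → x ∈ universe
    in-universe (base x∈ _)     = x∈
    in-universe (rule x∈ _ _ _) = x∈

    sound : ∀ {u f v} → Derivable (u , f , v) → Walk u f v
    sound (base _ (inj₁ e)) = subst (λ C → Walk _ C _) (⊗-identityʳ _) (e ∷ [])
    sound (base _ (inj₂ (refl , refl))) = []
    sound (rule _ p q (refl , refl , refl , refl)) = sound p ++ʷ sound q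

    -- A walk cut into derivable pieces, whose labels lie in `F` because the universe contains no
    -- others.
    data Chain : V → List Mat → V → Set where
      []  : ∀ {v} → Chain v [] v
      _∷_ : ∀ {u f v fs w} → Derivable (u , f , v) → Chain v fs w → Chain u (f ∷ fs) w

    chain : ∀ {u A v} → Walk u A v → ∃ λ fs → Chain u fs v × ∏ fs ≡ A
    chain [] = [] , [] , refl
    chain (_∷_ {f = f} e p) with fs , c , refl ← chain p
                            with u∈ , f∈ , v∈ ← E⊆ e =
      f ∷ fs , base (universe⁺ u∈ f∈ v∈) (inj₁ e) ∷ c , refl

    Shorter : V → List Mat → V → Set
    Shorter u fs v = ∃ λ gs → Chain u gs v × suc (length gs) ≡ length fs × ∏ gs ≡ ∏ fs

    -- Searches from the left for two neighbours with product in `F` and fuses them by `rule`. If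
    -- the search fails, all neighbours alternate by `F-product`.
    shorten : ∀ {u f g fs v} → Chain u (f ∷ g ∷ fs) v →
              Shorter u (f ∷ g ∷ fs) v ⊎ Linked Alternates (f ∷ g ∷ fs)
    shorten {f = f} {g} {fs} (p ∷ q ∷ c)
      with u∈ , f∈ , _  ← universe⁻ (in-universe p)
      with _  , g∈ , w∈ ← universe⁻ (in-universe q)
      with F-product f∈ g∈
    ... | inj₁ fg∈ = inj₁ (f ⊗ g ∷ fs , rule (universe⁺ u∈ fg∈ w∈) p q (refl , refl , refl , refl) ∷ c
                          , refl , ⊗-assoc f g (∏ fs))
    ... | inj₂ alt with fs | c
    ...   | []     | []    = inj₂ (alt ∷ [-])
    ...   | h ∷ hs | r ∷ c′ with shorten (q ∷ r ∷ c′)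
    ...     | inj₁ (gs , c″ , len , eq) = inj₁ (f ∷ gs , p ∷ c″ , cong suc len , cong (f ⊗_) eq)
    ...     | inj₂ linked               = inj₂ (alt ∷ linked)

    -- Repeated fusion ends in a single piece, whose label is then `I₂`: ping-pong excludes getting
    -- stuck at an alternating chain of two or more pieces.
    contract : ∀ n {u f fs v} → length fs ≡ n → Chain u (f ∷ fs) v → ∏ (f ∷ fs) ≡ I₂ →
               Derivable (u , I₂ , v)
    contract _ {f = f} {[]} _ (p ∷ []) eq =
      subst (λ g → Derivable (_ , g , _)) (trans (sym (⊗-identityʳ f)) eq) p
    contract (suc n) {fs = _ ∷ _} len c eq with shorten c
    ... | inj₂ linked = contradiction eq (alternating≢I linked)
    ... | inj₁ (g ∷ gs , c′ , len′ , eq′) =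
      contract n (ℕₚ.suc-injective (trans (ℕₚ.suc-injective len′) len)) c′ (trans eq′ eq)

    complete : ∀ {u v} → u ∈ vs → Walk u I₂ v → Derivable (u , I₂ , v)
    complete {u} u∈ p with fs , c , eq ← chain p =
      -- The empty walk put in front makes the chain nonempty even if `p` has no edges.
      contract _ refl (base (universe⁺ u∈ I∈F u∈) (inj₂ (refl , refl)) ∷ c)
        (trans (⊗-identityˡ (∏ fs)) eq)

  identityWalk? : ∀ {P : V → V → Set} → (∀ u v → Dec (P u v)) →
                  Dec (∃₂ λ u v → u ∈ vs × P u v × Walk u I₂ v)
  identityWalk? {P} P? with known , ds , closed ← saturate =
    map′ to from (any? (λ (u , f , v) → f ≟ I₂ ×-dec P? u v) known)
    where
    to : Any (λ (u , f , v) → f ≡ I₂ × P u v) known → _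
    to p with (u , f , v) , x∈ , refl , puv ← find p =
      u , v , proj₁ (universe⁻ (in-universe (All.lookup ds x∈))) , puv , sound (All.lookup ds x∈)
    from : _ → Any (λ (u , f , v) → f ≡ I₂ × P u v) known
    from (u , v , u∈ , puv , p) = lose (closed (complete u∈ p)) (refl , puv)

-- Gauss reduction

opaque
  unfolding F det²

  F-det² : ∀ {f} → f ∈ F → det² f ≡ 1ℤ
  F-det² = All.lookup (toWitness {a? = all? (λ f → det² f ℤₚ.≟ 1ℤ) F} _)

-- The interval from -n to n: as `-[1+ m ]` is -(m+1), the negative half takes one index fewer.
range : ℕ → List ℤ
range n = map +_ (upTo (suc n)) ++ map -[1+_] (upTo n)

∈-range : ∀ {n} z → ∣ z ∣ ℕ.≤ n → z ∈ range n
∈-range (+ m)        m≤n = ∈-++⁺ˡ (∈-map⁺ +_ (∈-upTo⁺ (ℕ.s≤s m≤n)))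
∈-range {n} -[1+ m ] m<n = ∈-++⁺ʳ (map +_ (upTo (suc n))) (∈-map⁺ -[1+_] (∈-upTo⁺ m<n))

ball : ℕ → List Mat
ball n = cartesianProductWith (λ (a , b) (c , d) → mat a b c d) rows rows
  where rows = cartesianProduct (range n) (range n)

sq-bound : ∀ z {n} → z * z ≤ + n → ∣ z ∣ ℕ.≤ n
sq-bound z {n} z²≤n = ℕₚ.≤-trans (m≤m² ∣ z ∣) (ℤₚ.drop‿+≤+ (subst (_≤ + n) z²≡ z²≤n))
  where
  m≤m² : ∀ m → m ℕ.≤ m ℕ.* m
  m≤m² zero    = ℕ.z≤n
  m≤m² (suc m) = ℕₚ.m≤m*n (suc m) (suc m)
  z²≡ : z * z ≡ + (∣ z ∣ ℕ.* ∣ z ∣)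
  z²≡ = trans (sym (ℤₚ.0≤i⇒+∣i∣≡i (sq-nonNeg z))) (cong +_ (ℤₚ.abs-* z z))

opaque
  unfolding norm

  ∈-ball : ∀ {n} A → norm A ≤ + n → A ∈ ball n
  ∈-ball {n} (mat a b c d) bound =
    ∈-cartesianProductWith⁺ _
      (∈-cartesianProduct⁺ (entry a (b * b + c * c + d * d) (nn b c d) (e₁ a b c d))
                           (entry b (a * a + c * c + d * d) (nn a c d) (e₂ a b c d)))
      (∈-cartesianProduct⁺ (entry c (a * a + b * b + d * d) (nn a b d) (e₃ a b c d))
                           (entry d (a * a + b * b + c * c) (nn a b c) (e₄ a b c d)))
    where
    nn : ∀ x y z → 0ℤ ≤ x * x + y * y + z * z
    nn x y z = ℤₚ.+-mono-≤ (ℤₚ.+-mono-≤ (sq-nonNeg x) (sq-nonNeg y)) (sq-nonNeg z)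
    entry : ∀ x r → 0ℤ ≤ r → norm (mat a b c d) ≡ x * x + r → x ∈ range n
    entry x r 0≤r eq = ∈-range x (sq-bound x (ℤₚ.≤-trans (≤-by r 0≤r eq) bound))
    e₁ : ∀ a b c d → a * a + b * b + c * c + d * d ≡ a * a + (b * b + c * c + d * d)
    e₁ = solve-∀
    e₂ : ∀ a b c d → a * a + b * b + c * c + d * d ≡ b * b + (a * a + c * c + d * d)
    e₂ = solve-∀
    e₃ : ∀ a b c d → a * a + b * b + c * c + d * d ≡ c * c + (a * a + b * b + d * d)
    e₃ = solve-∀
    e₄ : ∀ a b c d → a * a + b * b + c * c + d * d ≡ d * d + (a * a + b * b + c * c)
    e₄ = solve-∀

opaque
  unfolding F det² norm

  -- The entries lie between -2 and 2, which leaves 625 matrices to check.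
  short-unimodular : ∀ {A} → Unimodular A → norm A ≤ + 2 → A ∈ F
  short-unimodular {A} u short = All.lookup table (∈-ball A short) u short
    where
    table : All (λ A → Unimodular A → norm A ≤ + 2 → A ∈ F) (ball 2)
    table = toWitness {a? = all? (λ A → det² A ℤₚ.≟ 1ℤ →-dec norm A ℤₚ.≤? + 2 →-dec A ∈? F) (ball 2)} _

-- For f = flipʳ and f = flipᶜ, the products flip ⊗ f and f ⊗ flip are the four elementary row
-- operations with coefficient ±1.
flip flipʳ flipᶜ : Mat
flip  = mat 1ℤ 0ℤ 0ℤ -1ℤ
flipʳ = mat 1ℤ 1ℤ 0ℤ -1ℤ
flipᶜ = mat 1ℤ 0ℤ -1ℤ -1ℤ

reflections : List Mat
reflections = flip ∷ flipʳ ∷ flipᶜ ∷ []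

reflection-involutive : ∀ {f} → f ∈ reflections → f ⊗ f ≡ I₂
reflection-involutive = All.lookup {P = λ f → f ⊗ f ≡ I₂} (refl ∷ refl ∷ refl ∷ [])

opaque
  unfolding norm

  reflection-norm : ∀ {f} → f ∈ reflections → norm f ≤ + 3
  reflection-norm = All.lookup (toWitness {a? = all? (λ f → norm f ℤₚ.≤? + 3) reflections} _)

opaque
  unfolding F

  reflection∈F : ∀ {f} → f ∈ reflections → f ∈ F
  reflection∈F = All.lookup (toWitness {a? = all? (_∈? F) reflections} _)

-- The bound norm H ≤ (4/3) det² H + 1, multiplied by 6 to match the identity behind
-- `unshortenable⇒reduced`.
Reduced : Mat → Set
Reduced H = + 6 * norm H ≤ + 8 * det² H + + 6

Shortens : Mat → Mat → Mat → Set
Shortens H f g = norm (g ⊗ (f ⊗ H)) < norm H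

-- The bound becomes 6 * norm H ≤ 14, whereas a norm of 3 or more would make the left side at least
-- 18.
reduced-unimodular : ∀ {H} → Reduced H → Unimodular H → norm H ≤ + 2
reduced-unimodular {H} reduced u = ℤₚ.≮⇒≥ λ 2<n → contradiction
  (ℤₚ.≤-trans (ℤₚ.*-monoˡ-≤-nonNeg (+ 6) (ℤₚ.i<j⇒suc[i]≤j 2<n))
             (subst (λ k → + 6 * norm H ≤ + 8 * k + + 6) u reduced))
  (λ { (+≤+ p) → toWitnessFalse {a? = 18 ℕ.≤? 14} _ p })

factors≥1 : ∀ {x y} → 0ℤ ≤ x → 0ℤ ≤ y → 1ℤ ≤ x * y → 1ℤ ≤ x × 1ℤ ≤ y
factors≥1 {+ zero}          _ _ (+≤+ ())
factors≥1 {+[1+ m ]} {+ zero} _ _ p with subst (1ℤ ≤_) (ℤₚ.*-zeroʳ +[1+ m ]) p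
... | +≤+ ()
factors≥1 {+[1+ m ]} {+[1+ n ]} _ _ _ = +≤+ (ℕ.s≤s ℕ.z≤n) , +≤+ (ℕ.s≤s ℕ.z≤n)

-- If no elementary row operation shortens the matrix with rows r₁ and r₂, then
-- 2∣r₁·r₂∣ is at most both r₁·r₁ and r₂·r₂, hence 3(r₁·r₁)(r₂·r₂) ≤ 4(det H)².
-- Moreover r₁·r₁ + r₂·r₂ ≤ (r₁·r₁)(r₂·r₂) + 1, as both factors are positive.
opaque
  unfolding det² norm

  unshortenable⇒reduced : ∀ H → Nonsingular H →
    (∀ {f g} → f ∈ reflections → g ∈ reflections → ¬ Shortens H f g) → Reduced H
  unshortenable⇒reduced H@(mat a b c d) det≢0 stuck =
    -- The first two products add up to 2pq - 8s², and the third is 6(p - 1)(q - 1). As pq - s² is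
    -- the squared determinant, the sum is exactly the difference of the two sides.
    ≤-by _ (ℤₚ.+-mono-≤ (ℤₚ.+-mono-≤ (*-nonNeg p-2s q+2s) (*-nonNeg p+2s q-2s))
                         (*-nonNeg (*-nonNeg {+ 6} (+≤+ ℕ.z≤n) (ℤₚ.i≤j⇒0≤j-i p≥1)) (ℤₚ.i≤j⇒0≤j-i q≥1)))
      (identity a b c d)
    where
    p q s : ℤ
    p = a * a + b * b
    q = c * c + d * d
    s = a * c + b * d
    gap : ∀ {f g} → f ∈ reflections → g ∈ reflections → 0ℤ ≤ norm ((g ⊗ f) ⊗ H) - norm H
    gap {f} {g} f∈ g∈ = subst (λ A → 0ℤ ≤ norm A - norm H) (sym (⊗-assoc g f H))
                          (ℤₚ.i≤j⇒0≤j-i (ℤₚ.≮⇒≥ (stuck f∈ g∈)))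
    row₁ : ∀ k a b c d →
      (1ℤ * a + k * c) * (1ℤ * a + k * c) + (1ℤ * b + k * d) * (1ℤ * b + k * d)
      + (0ℤ * a + 1ℤ * c) * (0ℤ * a + 1ℤ * c) + (0ℤ * b + 1ℤ * d) * (0ℤ * b + 1ℤ * d)
      - (a * a + b * b + c * c + d * d) ≡ k * k * (c * c + d * d) + k * (+ 2 * (a * c + b * d))
    row₁ = solve-∀
    row₂ : ∀ k a b c d →
      (1ℤ * a + 0ℤ * c) * (1ℤ * a + 0ℤ * c) + (1ℤ * b + 0ℤ * d) * (1ℤ * b + 0ℤ * d)
      + (k * a + 1ℤ * c) * (k * a + 1ℤ * c) + (k * b + 1ℤ * d) * (k * b + 1ℤ * d)
      - (a * a + b * b + c * c + d * d) ≡ k * k * (a * a + b * b) + k * (+ 2 * (a * c + b * d))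
    row₂ = solve-∀
    plus : ∀ x y → 1ℤ * 1ℤ * x + 1ℤ * y ≡ x + y
    plus = solve-∀
    minus : ∀ x y → -1ℤ * -1ℤ * x + -1ℤ * y ≡ x - y
    minus = solve-∀
    -- `flipʳ ⊗ flip` subtracts the second row from the first; the next three combinations are the
    -- other row operations.
    q-2s : 0ℤ ≤ q - + 2 * s
    q-2s = subst (0ℤ ≤_) (trans (row₁ -1ℤ a b c d) (minus q (+ 2 * s)))
             (gap (here refl) (there (here refl)))
    q+2s : 0ℤ ≤ q + + 2 * s
    q+2s = subst (0ℤ ≤_) (trans (row₁ 1ℤ a b c d) (plus q (+ 2 * s)))
             (gap (there (here refl)) (here refl))
    p-2s : 0ℤ ≤ p - + 2 * s
    p-2s = subst (0ℤ ≤_) (trans (row₂ -1ℤ a b c d) (minus p (+ 2 * s)))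
             (gap (here refl) (there (there (here refl))))
    p+2s : 0ℤ ≤ p + + 2 * s
    p+2s = subst (0ℤ ≤_) (trans (row₂ 1ℤ a b c d) (plus p (+ 2 * s)))
             (gap (there (there (here refl))) (here refl))
    lagrange : ∀ a b c d → (a * a + b * b) * (c * c + d * d) ≡
               (a * d - b * c) * (a * d - b * c) + (a * c + b * d) * (a * c + b * d)
    lagrange = solve-∀
    pq≥1 : 1ℤ ≤ p * q
    pq≥1 = ℤₚ.≤-trans (sq≥1 det≢0) (≤-by (s * s) (sq-nonNeg s) (lagrange a b c d))
    p,q≥1 : 1ℤ ≤ p × 1ℤ ≤ q
    p,q≥1 = factors≥1 (ℤₚ.+-mono-≤ (sq-nonNeg a) (sq-nonNeg b))
                      (ℤₚ.+-mono-≤ (sq-nonNeg c) (sq-nonNeg d)) pq≥1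
    p≥1 : 1ℤ ≤ p
    p≥1 = proj₁ p,q≥1
    q≥1 : 1ℤ ≤ q
    q≥1 = proj₂ p,q≥1
    identity : ∀ a b c d →
      + 8 * ((a * d - b * c) * (a * d - b * c)) + + 6 ≡ + 6 * (a * a + b * b + c * c + d * d) +
       (((a * a + b * b) - + 2 * (a * c + b * d)) * ((c * c + d * d) + + 2 * (a * c + b * d))
       + ((a * a + b * b) + + 2 * (a * c + b * d)) * ((c * c + d * d) - + 2 * (a * c + b * d))
       + + 6 * ((a * a + b * b) - 1ℤ) * ((c * c + d * d) - 1ℤ))
    identity = solve-∀

-- Keeps the row operations and not only the result, since they are replayed as edges of the graph.
-- Each is split into two reflections because it is not itself in `F`.
data Descent : Mat → Mat → Set where
  done    : ∀ {H} → Reduced H → Descent H H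
  descend : ∀ {H f g H′} → f ∈ reflections → g ∈ reflections → Shortens H f g →
            Descent (g ⊗ (f ⊗ H)) H′ → Descent H H′

det²-F-⊗ : ∀ {f} A → f ∈ F → det² (f ⊗ A) ≡ det² A
det²-F-⊗ {f} A f∈ = trans (det²-⊗ f A) (trans (cong (_* det² A) (F-det² f∈)) (ℤₚ.*-identityˡ (det² A)))

opaque
  unfolding det²

  det²≢0 : ∀ A → Nonsingular A → det² A ≢ 0ℤ
  det²≢0 A p q with ℤₚ.i*j≡0⇒i≡0∨j≡0 (det A) q
  ... | inj₁ z = p z
  ... | inj₂ z = p z

  det²≢0⇒nonsingular : ∀ A → det² A ≢ 0ℤ → Nonsingular A
  det²≢0⇒nonsingular A p q = p (cong (λ k → k * k) q)

nonsingular-F-⊗ : ∀ {f} A → f ∈ F → Nonsingular A → Nonsingular (f ⊗ A)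
nonsingular-F-⊗ {f} A f∈ ns =
  det²≢0⇒nonsingular (f ⊗ A) (subst (_≢ 0ℤ) (sym (det²-F-⊗ A f∈)) (det²≢0 A ns))

descent : ∀ H → Nonsingular H → ∃ λ H′ → Descent H H′
descent H = go (suc ∣ norm H ∣) H ℕₚ.≤-refl
  where
  go : ∀ n H → ∣ norm H ∣ ℕ.< n → Nonsingular H → ∃ λ H′ → Descent H H′
  go (suc n) H (ℕ.s≤s size) ns
    with any? (λ f → any? (λ g → norm (g ⊗ (f ⊗ H)) ℤₚ.<? norm H) reflections) reflections
  ... | no stuck = H , done (unshortenable⇒reduced H ns λ f∈ g∈ s → stuck (lose f∈ (lose g∈ s)))
  ... | yes p
    with f , f∈ , q ← find p
    with g , g∈ , s ← find q =
    let G = g ⊗ (f ⊗ H)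
        smaller = ℤₚ.drop‿+<+ (subst₂ _<_ (sym (ℤₚ.0≤i⇒+∣i∣≡i (norm-nonNeg G)))
                                           (sym (ℤₚ.0≤i⇒+∣i∣≡i (norm-nonNeg H))) s)
        H′ , r = go n G (ℕₚ.<-≤-trans smaller size)
                   (nonsingular-F-⊗ (f ⊗ H) (reflection∈F g∈) (nonsingular-F-⊗ H (reflection∈F f∈) ns))
    in H′ , descend f∈ g∈ s r

-- Rational sets of integer matrices

record Machine : Set₁ where
  field
    State     : Set
    _≟ₛ_      : DecidableEquality State
    states    : List State
    complete  : ∀ q → q ∈ states
    labels    : List Mat
    Step      : State → Mat → State → Set
    step?     : ∀ q A q′ → Dec (Step q A q′)
    labelled  : ∀ {q A q′} → Step q A q′ → A ∈ labels
    Initial   : State → Set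
    initial?  : Decidable Initial
    Final     : State → Set
    final?    : Decidable Final

  open Walks Step public using () renaming (Walk to Run; [] to []ʳ; _∷_ to _∷ʳ_)

  Recognises : Mat → Set
  Recognises A = ∃₂ λ p q → Initial p × Final q × Run p A q

-- A run on T is followed by a walk on pairs (state , remainder), where the
-- remainder H satisfies (product read so far) = (product of the labels of the walk) ⊗ H.
-- Remainders are kept reduced, so that finitely many suffice. A preliminary walk from G
-- to I₂ with the label G turns the condition on the labels into triviality of their product.
module Membership (𝓜 : Machine) {T : Mat} (T-nonsingular : Nonsingular T) where
  open Machine 𝓜

  -- Stands in for the maximum of the norms. The 1 for the empty list ensures `k₀ ≤ k₁`.
  normSum : List Mat → ℤ
  normSum []       = 1ℤ
  normSum (A ∷ As) = norm A + normSum As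

  normSum≥1 : ∀ As → 1ℤ ≤ normSum As
  normSum≥1 []       = ℤₚ.≤-refl
  normSum≥1 (A ∷ As) = ℤₚ.+-mono-≤ (norm-nonNeg A) (normSum≥1 As)

  norm≤normSum : ∀ {A As} → A ∈ As → norm A ≤ normSum As
  norm≤normSum {A} {_ ∷ As} (here refl) = ≤-by (normSum As) (ℤₚ.≤-trans (+≤+ ℕ.z≤n) (normSum≥1 As)) refl
  norm≤normSum {A} {B ∷ As} (there A∈)  =
    subst (_≤ norm B + normSum As) (ℤₚ.+-identityˡ (norm A))
          (ℤₚ.+-mono-≤ (norm-nonNeg B) (norm≤normSum A∈))

  opaque
    unfolding det² norm

    -- k₀ bounds the norm of a reduced remainder, k₁ its norm after another label has been read,
    -- and 3 * k₁ the norm after the first of the two reflections in a row operation.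
    k₀ k₁ : ℤ
    k₀ = + 8 * det² T + + 6
    k₁ = k₀ * normSum (T ∷ labels)

    reduced⇒≤k₀ : ∀ {H} → Reduced H → det² H ≤ det² T → norm H ≤ k₀
    reduced⇒≤k₀ {H} reduced small =
      ℤₚ.≤-trans (≤-scale {norm H} {+ 6} (norm-nonNeg H) (+≤+ (ℕ.s≤s ℕ.z≤n)))
      (ℤₚ.≤-trans reduced (ℤₚ.+-monoˡ-≤ (+ 6) (ℤₚ.*-monoˡ-≤-nonNeg (+ 8) small)))

    0≤k₀ : 0ℤ ≤ k₀
    0≤k₀ = ℤₚ.+-mono-≤ (*-nonNeg {+ 8} (+≤+ ℕ.z≤n) (sq-nonNeg (det T))) (+≤+ ℕ.z≤n)

    2≤k₀ : + 2 ≤ k₀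
    2≤k₀ = ℤₚ.+-mono-≤ (*-nonNeg {+ 8} (+≤+ ℕ.z≤n) (sq-nonNeg (det T))) (+≤+ (ℕ.s≤s (ℕ.s≤s ℕ.z≤n)))

    norm-I≤k₀ : norm I₂ ≤ k₀
    norm-I≤k₀ = 2≤k₀

    -- The detour through `B` admits the factor `adj T`, which has the same norm as `T`.
    ⊗-≤k₁ : ∀ {H A B} → norm H ≤ k₀ → norm A ≡ norm B → B ∈ T ∷ labels → norm (H ⊗ A) ≤ k₁
    ⊗-≤k₁ {H} {A} h eq B∈ = norm-⊗-≤ H A h (ℤₚ.≤-trans (ℤₚ.≤-reflexive eq) (norm≤normSum B∈))

    k₀≤k₁ : k₀ ≤ k₁
    k₀≤k₁ = subst (k₀ ≤_) (ℤₚ.*-comm (normSum (T ∷ labels)) k₀) (≤-scale 0≤k₀ (normSum≥1 (T ∷ labels)))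

    remainders : List Mat
    remainders = ball ∣ + 3 * k₁ ∣

    ∈-remainders₃ : ∀ {H} → norm H ≤ + 3 * k₁ → H ∈ remainders
    ∈-remainders₃ {H} h = ∈-ball H
      (subst (norm H ≤_) (sym (ℤₚ.0≤i⇒+∣i∣≡i (ℤₚ.≤-trans (norm-nonNeg H) h))) h)

    ∈-remainders : ∀ {H} → norm H ≤ k₁ → H ∈ remainders
    ∈-remainders h =
      ∈-remainders₃ (ℤₚ.≤-trans h (≤-scale {k₁} {+ 3} (ℤₚ.≤-trans 0≤k₀ k₀≤k₁) (+≤+ (ℕ.s≤s ℕ.z≤n))))

  Node : Set
  Node = State × Mat

  _≟ₙ_ : DecidableEquality Node
  _≟ₙ_ = ×ₚ.≡-dec _≟ₛ_ _≟_

  nodes : List Node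
  nodes = cartesianProduct states remainders

  ∈-nodes : ∀ {q H} → H ∈ remainders → (q , H) ∈ nodes
  ∈-nodes {q} = ∈-cartesianProduct⁺ (complete q)

  -- A `Reads` edge multiplies the remainder by a label on the right and emits `I₂`; a `Factors`
  -- edge splits a letter of `F` off its left side and emits that letter.
  Reads : Node → Mat → Node → Set
  Reads (q , H) f (q′ , H′) = f ≡ I₂ × Any (λ A → Step q A q′ × H ⊗ A ≡ H′) labels

  Factors : Node → Mat → Node → Set
  Factors (q , H) f (q′ , H′) = q ≡ q′ × H ≡ f ⊗ H′

  Edge : Node → Mat → Node → Set
  Edge u f v = (u ∈ nodes × f ∈ F × v ∈ nodes) × (Reads u f v ⊎ Factors u f v)

  edge? : ∀ u f v → Dec (Edge u f v)
  edge? u@(q , H) f v@(q′ , H′) =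
    (u ∈ₙ? nodes ×-dec f ∈? F ×-dec v ∈ₙ? nodes) ×-dec
    ((f ≟ I₂ ×-dec any? (λ A → step? q A q′ ×-dec H ⊗ A ≟ H′) labels) ⊎-dec
     (q ≟ₛ q′ ×-dec H ≟ f ⊗ H′))
    where open DecMembership _≟ₙ_ using () renaming (_∈?_ to _∈ₙ?_)

  open Walks Edge
  open IdentityWalks _≟ₙ_ nodes edge? proj₁

  walk-sound : ∀ {q H U q′ H′} → Walk (q , H) U (q′ , H′) → ∃ λ P → Run q P q′ × H ⊗ P ≡ U ⊗ H′
  walk-sound {H = H} [] = I₂ , []ʳ , trans (⊗-identityʳ H) (sym (⊗-identityˡ H))
  walk-sound {q} {H} {q′ = q′} {H′ = H′} (_∷_ {v = r , _} {A = U} (_ , inj₁ (refl , reads)) walk)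
    with A , _ , s , refl ← find reads
    with P , run , eq ← walk-sound walk =
    A ⊗ P , s ∷ʳ run , trans (sym (⊗-assoc H A P)) (trans eq (cong (_⊗ H′) (sym (⊗-identityˡ U))))
  walk-sound {H′ = H′} (_∷_ {f = f} {v = _ , H} {A = U} (_ , inj₂ (refl , refl)) walk)
    with P , run , eq ← walk-sound walk =
    P , run , trans (⊗-assoc f H P) (trans (cong (f ⊗_) eq) (sym (⊗-assoc f U H′)))

  opaque
    unfolding det²

    walk-unimodular : ∀ {u U v} → Walk u U v → Unimodular U
    walk-unimodular [] = refl
    walk-unimodular (_∷_ {f = f} {A = U} ((_ , f∈ , _) , _) walk) =
      trans (det²-F-⊗ U f∈) (walk-unimodular walk)

  reflect : ∀ {q f H} → f ∈ reflections → H ∈ remainders → f ⊗ H ∈ remainders →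
            Edge (q , H) f (q , f ⊗ H)
  reflect {f = f} {H} f∈ H∈ fH∈ =
    (∈-nodes H∈ , reflection∈F f∈ , ∈-nodes fH∈) , inj₂ (refl , (begin
      H            ≡⟨ ⊗-identityˡ H ⟨
      I₂ ⊗ H       ≡⟨ cong (_⊗ H) (reflection-involutive f∈) ⟨
      (f ⊗ f) ⊗ H  ≡⟨ ⊗-assoc f f H ⟩
      f ⊗ (f ⊗ H)  ∎))
    where open ≡-Reasoning

  read : ∀ {q A q′ H} → Step q A q′ → H ∈ remainders → H ⊗ A ∈ remainders →
         Edge (q , H) I₂ (q′ , H ⊗ A)
  read s H∈ HA∈ = (∈-nodes H∈ , I∈F , ∈-nodes HA∈) , inj₁ (refl , lose (labelled s) (s , refl))

  Reduction : State → Mat → Set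
  Reduction q H = ∃₂ λ U H′ → Walk (q , H) U (q , H′) × H ≡ U ⊗ H′ × Reduced H′

  -- Each row operation becomes two `reflect` edges. Between operations the norm stays below `k₁`,
  -- but the first reflection may triple it, hence the radius of `remainders`.
  descent-walk : ∀ {q H H′} → Descent H H′ → norm H ≤ k₁ → Reduction q H
  descent-walk {H = H} (done reduced) _ = I₂ , H , [] , sym (⊗-identityˡ H) , reduced
  descent-walk {q} {H} (descend {f = f} {g} f∈ g∈ shorter d) h =
    let short = ℤₚ.≤-trans (ℤₚ.<⇒≤ shorter) h
        U , H″ , walk , eq , reduced = descent-walk {q} d short
        fH∈ = ∈-remainders₃ (norm-⊗-≤ f H (reflection-norm f∈) h)
        e₁ = reflect {q} f∈ (∈-remainders h) fH∈
        e₂ = reflect {q} g∈ fH∈ (∈-remainders short)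
    in f ⊗ (g ⊗ U) , H″ , e₁ ∷ e₂ ∷ walk , (begin
         H                      ≡⟨ unfold f∈ H ⟩
         f ⊗ (f ⊗ H)            ≡⟨ cong (f ⊗_) (unfold g∈ (f ⊗ H)) ⟩
         f ⊗ (g ⊗ (g ⊗ (f ⊗ H))) ≡⟨ cong (λ A → f ⊗ (g ⊗ A)) eq ⟩
         f ⊗ (g ⊗ (U ⊗ H″))     ≡⟨ cong (f ⊗_) (⊗-assoc g U H″) ⟨
         f ⊗ ((g ⊗ U) ⊗ H″)     ≡⟨ ⊗-assoc f (g ⊗ U) H″ ⟨
         (f ⊗ (g ⊗ U)) ⊗ H″     ∎) , reduced
    where
    open ≡-Reasoning
    unfold : ∀ {f} → f ∈ reflections → ∀ A → A ≡ f ⊗ (f ⊗ A)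
    unfold {f} f∈ A = trans (sym (⊗-identityˡ A))
      (trans (cong (_⊗ A) (sym (reflection-involutive f∈))) (⊗-assoc f f A))

  reduce : ∀ q {H} → Nonsingular H → norm H ≤ k₁ → Reduction q H
  reduce q {H} ns h = descent-walk (proj₂ (descent H ns)) h

  det²-reduction : ∀ {q H U H′} → Walk (q , H) U (q , H′) → H ≡ U ⊗ H′ → det² H′ ≡ det² H
  det²-reduction {H = H} {U} {H′} walk eq = begin
    det² H′          ≡⟨ ℤₚ.*-identityˡ (det² H′) ⟨
    1ℤ * det² H′     ≡⟨ cong (_* det² H′) (walk-unimodular walk) ⟨
    det² U * det² H′ ≡⟨ det²-⊗ U H′ ⟨
    det² (U ⊗ H′)    ≡⟨ cong det² eq ⟨
    det² H           ∎
    where open ≡-Reasoning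

  opaque
    unfolding det²

    -- `det² A` and `det² B` have a nonzero product, so both are at least 1 and neither exceeds it.
    -- This bounds the determinants of all partial products of a run.
    det²-factor : ∀ A B → det² (A ⊗ B) ≡ det² T → Nonsingular A × det² A ≤ det² T
    det²-factor A B eq = A-nonsingular , subst (det² A ≤_) (trans (ℤₚ.*-comm (det² B) (det² A)) prod)
                                           (≤-scale (sq-nonNeg (det A)) (sq≥1 B-nonsingular))
      where
      prod : det² A * det² B ≡ det² T
      prod = trans (sym (det²-⊗ A B)) eq
      A-nonsingular : Nonsingular A
      A-nonsingular z = det²≢0 T T-nonsingular (trans (sym prod) (cong (λ k → k * k * det² B) z))
      B-nonsingular : Nonsingular B
      B-nonsingular z = det²≢0 T T-nonsingular
        (trans (sym prod) (trans (cong (λ k → det² A * (k * k)) z) (ℤₚ.*-zeroʳ (det² A))))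

  det²-⊗-congˡ : ∀ A B P → det² A ≡ det² B → det² (A ⊗ P) ≡ det² (B ⊗ P)
  det²-⊗-congˡ A B P e = trans (det²-⊗ A P) (trans (cong (_* det² P) e) (sym (det²-⊗ B P)))

  Followed : State → Mat → Mat → State → Set
  Followed q H P q′ = ∃₂ λ U H′ → Walk (q , H) U (q′ , H′) × H ⊗ P ≡ U ⊗ H′ × norm H′ ≤ k₀

  prepend : ∀ {q r q′} H A P U H₁ → Edge (q , H) I₂ (r , H ⊗ A) → Walk (r , H ⊗ A) U (r , H₁) →
            H ⊗ A ≡ U ⊗ H₁ → Followed r H₁ P q′ → Followed q H (A ⊗ P) q′
  prepend H A P U H₁ edge walk e₁ (V , H₂ , walk′ , e₂ , h) =
    I₂ ⊗ (U ⊗ V) , H₂ , edge ∷ (walk ++ʷ walk′) , (begin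
      H ⊗ (A ⊗ P)          ≡⟨ ⊗-assoc H A P ⟨
      (H ⊗ A) ⊗ P          ≡⟨ cong (_⊗ P) e₁ ⟩
      (U ⊗ H₁) ⊗ P         ≡⟨ ⊗-assoc U H₁ P ⟩
      U ⊗ (H₁ ⊗ P)         ≡⟨ cong (U ⊗_) e₂ ⟩
      U ⊗ (V ⊗ H₂)         ≡⟨ ⊗-assoc U V H₂ ⟨
      (U ⊗ V) ⊗ H₂         ≡⟨ cong (_⊗ H₂) (⊗-identityˡ (U ⊗ V)) ⟨
      (I₂ ⊗ (U ⊗ V)) ⊗ H₂  ∎) , h
    where open ≡-Reasoning

  -- The remainder is reduced again after each label. The condition on `det²` passes from step to
  -- step and bounds the determinant of each remainder by that of `T`, so reduction brings the norm
  -- back below `k₀`.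
  follow : ∀ {q P q′} H → Run q P q′ → norm H ≤ k₀ → det² (H ⊗ P) ≡ det² T → Followed q H P q′
  follow H []ʳ h _ = I₂ , H , [] , trans (⊗-identityʳ H) (sym (⊗-identityˡ H)) , h
  follow {q} {q′ = q′} H (_∷ʳ_ {f = A} {v = r} {A = P} s run) h eq =
    continue (reduce r {H ⊗ A} (proj₁ factor) HA≤k₁)
    where
    HA≤k₁ : norm (H ⊗ A) ≤ k₁
    HA≤k₁ = ⊗-≤k₁ {H} {A} {A} h refl (there (labelled s))
    eq′ : det² ((H ⊗ A) ⊗ P) ≡ det² T
    eq′ = trans (cong det² (⊗-assoc H A P)) eq
    factor : Nonsingular (H ⊗ A) × det² (H ⊗ A) ≤ det² T
    factor = det²-factor (H ⊗ A) P eq′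
    continue : Reduction r (H ⊗ A) → Followed q H (A ⊗ P) q′
    continue (U , H₁ , walk , e , reduced) =
      prepend H A P U H₁ (read s (∈-remainders {H} (ℤₚ.≤-trans h k₀≤k₁))
                               (∈-remainders {H ⊗ A} HA≤k₁)) walk e
        (follow H₁ run (reduced⇒≤k₀ {H₁} reduced (subst (_≤ det² T) (sym det²H₁) (proj₂ factor)))
                       (trans (det²-⊗-congˡ H₁ (H ⊗ A) P det²H₁) eq′))
      where
      det²H₁ : det² H₁ ≡ det² (H ⊗ A)
      det²H₁ = det²-reduction walk e

  -- A walk labelled `I₂` between such nodes reads a `P` with G ⊗ P ≡ H ≡ G ⊗ T, and cancelling `G`
  -- gives P ≡ T.
  Endpoints : Node → Node → Set
  Endpoints (p , G) (q , H) = Initial p × Final q × Unimodular G × G ⊗ T ≡ H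

  endpoints? : ∀ u v → Dec (Endpoints u v)
  endpoints? (p , G) (q , H) = initial? p ×-dec final? q ×-dec det² G ℤₚ.≟ 1ℤ ×-dec G ⊗ T ≟ H

  opaque
    unfolding det² norm

    -- `H ⊗ adj T` equals `det T · G`, so its norm bounds that of `G`. This is why `T` joins the
    -- labels in `k₁`.
    unimodular-≤k₁ : ∀ G H → G ⊗ T ≡ H → norm H ≤ k₀ → norm G ≤ k₁
    unimodular-≤k₁ G H eq h = ℤₚ.≤-trans (≤-scale (norm-nonNeg G) (sq≥1 T-nonsingular))
      (subst (_≤ k₁) (trans (cong norm scaled) (norm-· (det T) G))
        (⊗-≤k₁ {H} {adj T} {T} h (norm-adj T) (here refl)))
      where
      open ≡-Reasoning
      norm-adj : ∀ A → norm (adj A) ≡ norm A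
      norm-adj (mat a b c d) = identity a b c d
        where
        identity : ∀ a b c d → d * d + - b * - b + - c * - c + a * a ≡ a * a + b * b + c * c + d * d
        identity = solve-∀
      norm-· : ∀ k A → norm (k · A) ≡ k * k * norm A
      norm-· k (mat a b c d) = identity k a b c d
        where
        identity : ∀ k a b c d → k * a * (k * a) + k * b * (k * b) + k * c * (k * c) + k * d * (k * d)
                                 ≡ k * k * (a * a + b * b + c * c + d * d)
        identity = solve-∀
      scaled : H ⊗ adj T ≡ det T · G
      scaled = begin
        H ⊗ adj T          ≡⟨ cong (_⊗ adj T) eq ⟨
        (G ⊗ T) ⊗ adj T    ≡⟨ ⊗-assoc G T (adj T) ⟩
        G ⊗ (T ⊗ adj T)    ≡⟨ cong (G ⊗_) (adj-inverseʳ T) ⟩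
        G ⊗ (det T · I₂)   ≡⟨ ⊗-·I G (det T) ⟩
        det T · G          ∎

  -- Reduction leaves a remainder that is both reduced and unimodular, hence a letter of `F`; one
  -- last edge splits it off and leaves `I₂`.
  unimodular-walk : ∀ q G → Unimodular G → norm G ≤ k₁ → Walk (q , G) G (q , I₂)
  unimodular-walk q G u g =
    let U , H , walk , eq , reduced = reduce q {G} (unimodular⇒nonsingular G u) g
        H-unimodular = trans (det²-reduction walk eq) u
        H≤2 = reduced-unimodular {H} reduced H-unimodular
        edge : Edge (q , H) H (q , I₂)
        edge = (∈-nodes (∈-remainders (ℤₚ.≤-trans H≤2 (ℤₚ.≤-trans 2≤k₀ k₀≤k₁)))
               , short-unimodular {H} H-unimodular H≤2
               , ∈-nodes (∈-remainders I≤k₁)) , inj₂ (refl , sym (⊗-identityʳ H))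
    in subst (λ A → Walk (q , G) A (q , I₂))
         (trans (cong (U ⊗_) (⊗-identityʳ H)) (sym eq)) (walk ++ʷ edge ∷ [])
    where
    I≤k₁ : norm I₂ ≤ k₁
    I≤k₁ = ℤₚ.≤-trans norm-I≤k₀ k₀≤k₁

  Witness : Set
  Witness = ∃₂ λ u v → u ∈ nodes × Endpoints u v × Walk u I₂ v

  witness⇒recognises : Witness → Recognises T
  witness⇒recognises ((p , G) , (q , H) , _ , (init , fin , u , GT≡H) , walk) =
    p , q , init , fin , run (walk-sound walk)
    where
    run : (∃ λ P → Run p P q × G ⊗ P ≡ I₂ ⊗ H) → Run p T q
    run (P , r , GP≡H) = subst (λ A → Run p A q)
      (⊗-cancelˡ G {P} {T} (unimodular⇒nonsingular G u)
         (trans GP≡H (trans (⊗-identityˡ H) (sym GT≡H)))) r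

  -- `G` inverts the label `U` of the walk that follows the run, so the preliminary walk labelled
  -- `G` makes the total `I₂`.
  witness : ∀ {p q U H G} → Initial p → Final q → Walk (p , I₂) U (q , H) → T ≡ U ⊗ H → norm H ≤ k₀ →
            Unimodular G → G ⊗ U ≡ I₂ → Witness
  witness {p} {q} {U} {H} {G} init fin walk T≡UH h u GU≡I =
    (p , G) , (q , H) , ∈-nodes (∈-remainders G≤k₁) , (init , fin , u , GT≡H)
    , subst (λ A → Walk (p , G) A (q , H)) GU≡I (unimodular-walk p G u G≤k₁ ++ʷ walk)
    where
    open ≡-Reasoning
    GT≡H : G ⊗ T ≡ H
    GT≡H = begin
      G ⊗ T        ≡⟨ cong (G ⊗_) T≡UH ⟩
      G ⊗ (U ⊗ H)  ≡⟨ ⊗-assoc G U H ⟨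
      (G ⊗ U) ⊗ H  ≡⟨ cong (_⊗ H) GU≡I ⟩
      I₂ ⊗ H       ≡⟨ ⊗-identityˡ H ⟩
      H            ∎
    G≤k₁ : norm G ≤ k₁
    G≤k₁ = unimodular-≤k₁ G H GT≡H h

  recognises⇒witness : Recognises T → Witness
  recognises⇒witness (p , q , init , fin , run) =
    build (follow I₂ run norm-I≤k₀ (cong det² (⊗-identityˡ T)))
    where
    build : Followed p I₂ T q → Witness
    build (U , H , walk , eq , h) = witness init fin walk (trans (sym (⊗-identityˡ T)) eq) h
      (proj₁ (proj₂ G)) (proj₂ (proj₂ G))
      where
      G : ∃ λ G → Unimodular G × G ⊗ U ≡ I₂
      G = inverse U (walk-unimodular walk)

  recognises? : Dec (Recognises T)
  recognises? = map′ witness⇒recognises recognises⇒witness (identityWalk? endpoints?)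

-- The alternating product as a rational set

letters : List Σ
letters = X ∷ N ∷ S ∷ R ∷ []

∈-letters : ∀ x → x ∈ letters
∈-letters X = here refl
∈-letters N = there (here refl)
∈-letters S = there (there (here refl))
∈-letters R = there (there (there (here refl)))

-- Recognises only `I₂` and ends the recursion in `alternation`.
trivial : Machine
trivial = record
  { State = ⊤ ; _≟ₛ_ = ⊤ₚ._≟_ ; states = tt ∷ [] ; complete = λ _ → here refl ; labels = []
  ; Step = λ _ _ _ → ⊥ ; step? = λ _ _ _ → no λ () ; labelled = λ ()
  ; Initial = λ _ → ⊤ ; initial? = λ _ → yes tt ; Final = λ _ → ⊤ ; final? = λ _ → yes tt }

-- Concatenation: a copy of `𝓐` reading its letters as matrices, then one transition labelled `M`
-- into `𝓜`.
module Prefix (𝓐 : NFA) (M : Mat) (𝓜 : Machine) where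
  open NFA 𝓐 renaming (states to size)
  open Machine 𝓜

  data Step⁺ : Fin size ⊎ State → Mat → Fin size ⊎ State → Set where
    letter : ∀ {q x q′} → δ q x q′ ≡ true → Step⁺ (inj₁ q) (φₗ x) (inj₁ q′)
    bridge : ∀ {q r} → final q ≡ true → Initial r → Step⁺ (inj₁ q) M (inj₂ r)
    later  : ∀ {r A r′} → Step r A r′ → Step⁺ (inj₂ r) A (inj₂ r′)

  step⁺? : ∀ u A v → Dec (Step⁺ u A v)
  step⁺? (inj₁ q) A (inj₁ q′) =
    map′ to from (any? (λ x → (δ q x q′ Boolₚ.≟ true) ×-dec (A ≟ φₗ x)) letters)
    where
    to : Any (λ x → δ q x q′ ≡ true × A ≡ φₗ x) letters → Step⁺ (inj₁ q) A (inj₁ q′)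
    to p with _ , _ , e , refl ← find p = letter e
    from : Step⁺ (inj₁ q) A (inj₁ q′) → Any (λ x → δ q x q′ ≡ true × A ≡ φₗ x) letters
    from (letter {x = x} e) = lose (∈-letters x) (e , refl)
  step⁺? (inj₁ q) A (inj₂ r)  =
    map′ (λ { (f , i , refl) → bridge f i }) (λ { (bridge f i) → f , i , refl })
         ((final q Boolₚ.≟ true) ×-dec initial? r ×-dec A ≟ M)
  step⁺? (inj₂ r) A (inj₁ q)  = no λ ()
  step⁺? (inj₂ r) A (inj₂ r′) = map′ later (λ { (later s) → s }) (step? r A r′)

  Initial⁺ Final⁺ : Fin size ⊎ State → Set
  Initial⁺ = Sum.[ (λ q → initial q ≡ true) , (λ _ → ⊥) ]
  Final⁺   = Sum.[ (λ _ → ⊥) , Final ]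

  prefix : Machine
  prefix = record
    { State    = Fin size ⊎ State
    ; _≟ₛ_     = ⊎ₚ.≡-dec Finₚ._≟_ _≟ₛ_
    ; states   = map inj₁ (allFin size) ++ map inj₂ states
    ; complete = λ { (inj₁ q) → ∈-++⁺ˡ (∈-map⁺ inj₁ (∈-allFin q))
                   ; (inj₂ r) → ∈-++⁺ʳ (map inj₁ (allFin size)) (∈-map⁺ inj₂ (complete r)) }
    ; labels   = map φₗ letters ++ M ∷ labels
    ; Step     = Step⁺
    ; step?    = step⁺?
    ; labelled = λ { (letter {x = x} _) → ∈-++⁺ˡ (∈-map⁺ φₗ (∈-letters x))
                   ; (bridge _ _) → ∈-++⁺ʳ (map φₗ letters) (here refl)
                   ; (later s)    → ∈-++⁺ʳ (map φₗ letters) (there (labelled s)) }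
    ; Initial  = Initial⁺
    ; initial? = λ { (inj₁ q) → initial q Boolₚ.≟ true ; (inj₂ _) → no id }
    ; Final    = Final⁺
    ; final?   = λ { (inj₁ _) → no id ; (inj₂ r) → final? r }
    }

  open Machine prefix using () renaming (Run to Run⁺; Recognises to Recognises⁺)
  open Walks using ([]; _∷_)

  later⁻ : ∀ {r P r′} → Run⁺ (inj₂ r) P (inj₂ r′) → Run r P r′
  later⁻ []              = []
  later⁻ (later s ∷ run) = s ∷ later⁻ run

  later⁺ : ∀ {r P r′} → Run r P r′ → Run⁺ (inj₂ r) P (inj₂ r′)
  later⁺ []        = []
  later⁺ (s ∷ run) = later s ∷ later⁺ run

  regroup : ∀ A B C P → A ⊗ ((B ⊗ C) ⊗ P) ≡ ((A ⊗ B) ⊗ C) ⊗ P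
  regroup A B C P = trans (sym (⊗-assoc A (B ⊗ C) P)) (cong (_⊗ P) (sym (⊗-assoc A B C)))

  split : ∀ {q P r′} → Run⁺ (inj₁ q) P (inj₂ r′) →
          ∃ λ w → AcceptsFrom 𝓐 q w × ∃₂ λ r P′ → Initial r × Run r P′ r′ × (φ w ⊗ M) ⊗ P′ ≡ P
  split (_∷_ {A = P} (bridge f i) run) =
    [] , done f , _ , P , i , later⁻ run , cong (_⊗ P) (⊗-identityˡ M)
  split (letter {x = x} e ∷ run)
    with w , acc , r , P′ , i , run′ , eq ← split run =
    x ∷ w , step e acc , r , P′ , i , run′
    , trans (sym (regroup (φₗ x) (φ w) M P′)) (cong (φₗ x ⊗_) eq)

  join : ∀ {q w r P r′} → AcceptsFrom 𝓐 q w → Initial r → Run r P r′ →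
         Run⁺ (inj₁ q) ((φ w ⊗ M) ⊗ P) (inj₂ r′)
  join {P = P} (done f) i run =
    subst (λ A → Run⁺ _ A _) (cong (_⊗ P) (sym (⊗-identityˡ M))) (bridge f i ∷ later⁺ run)
  join {P = P} (step {x = x} {w = w} e acc) i run =
    subst (λ A → Run⁺ _ A _) (regroup (φₗ x) (φ w) M P) (letter e ∷ join acc i run)

  prefix⁻ : ∀ {P} → Recognises⁺ P → ∃₂ λ A P′ → A ∈ᵣ 𝓐 × Recognises P′ × (A ⊗ M) ⊗ P′ ≡ P
  prefix⁻ (inj₁ q , inj₂ r′ , init , fin , run)
    with w , acc , r , P′ , i , run′ , eq ← split run =
    φ w , P′ , (w , (q , init , acc) , refl) , (r , r′ , i , fin , run′) , eq

  prefix⁺ : ∀ {A P} → A ∈ᵣ 𝓐 → Recognises P → Recognises⁺ ((A ⊗ M) ⊗ P)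
  prefix⁺ (w , (q , init , acc) , refl) (r , r′ , i , fin , run) =
    inj₁ q , inj₂ r′ , init , fin , join acc i run

open Prefix using (prefix; prefix⁻; prefix⁺)

alternation : ∀ k → (Fin (suc k) → NFA) → (Fin k → Mat) → Machine
-- No matrix follows the last factor, so the bridge carries `I₂`.
alternation zero    auts Ms = prefix (auts zero) I₂ trivial
alternation (suc k) auts Ms = prefix (auts zero) (Ms zero) (alternation k (auts ∘ suc) (Ms ∘ suc))

Product : ∀ k → (Fin (suc k) → NFA) → (Fin k → Mat) → Mat → Set
Product k auts Ms T = ∃ λ As → (∀ i → As i ∈ᵣ auts i) × alt k As Ms ≡ T

alternation⁻ : ∀ k auts Ms {T} → Machine.Recognises (alternation k auts Ms) T → Product k auts Ms T
alternation⁻ zero auts Ms rec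
  with A , _ , A∈ , (_ , _ , _ , _ , Walks.[]) , eq ← prefix⁻ (auts zero) I₂ trivial rec =
  (λ _ → A) , (λ { zero → A∈ }) , trans (sym (⊗-identityʳ A)) (trans (sym (⊗-identityʳ (A ⊗ I₂))) eq)
alternation⁻ (suc k) auts Ms rec
  with A , P , A∈ , rec′ , eq ← prefix⁻ (auts zero) (Ms zero) (alternation k (auts ∘ suc) (Ms ∘ suc)) rec
  with As , As∈ , refl ← alternation⁻ k (auts ∘ suc) (Ms ∘ suc) rec′ =
  A Vector.∷ As , (λ { zero → A∈ ; (suc i) → As∈ i }) , eq

alternation⁺ : ∀ k auts Ms {T} → Product k auts Ms T → Machine.Recognises (alternation k auts Ms) T
alternation⁺ zero auts Ms {T} (As , As∈ , refl) =
  subst (Machine.Recognises (alternation zero auts Ms)) (trans (⊗-identityʳ (T ⊗ I₂)) (⊗-identityʳ T))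
    (prefix⁺ (auts zero) I₂ trivial (As∈ zero) (tt , tt , tt , tt , Walks.[]))
alternation⁺ (suc k) auts Ms (As , As∈ , refl) =
  prefix⁺ (auts zero) (Ms zero) (alternation k (auts ∘ suc) (Ms ∘ suc)) (As∈ zero)
    (alternation⁺ k (auts ∘ suc) (Ms ∘ suc) (As ∘ suc , As∈ ∘ suc , refl))

theorem4 : (k : ℕ) (auts : Fin (suc k) → NFA) (Ms : Fin k → Mat) (Mt : Mat) →
    (∀ i → Nonsingular (Ms i)) → Nonsingular Mt →
    Dec (∃ λ (As : Fin (suc k) → Mat) → (∀ i → As i ∈ᵣ auts i) × alt k As Ms ≡ Mt)
theorem4 k auts Ms Mt _ Mt-nonsingular =
  map′ (alternation⁻ k auts Ms) (alternation⁺ k auts Ms)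
    (Membership.recognises? (alternation k auts Ms) Mt-nonsingular)
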